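{- Let $R$ be a finite valuation ring of order $q^r$ and let $A, B, C$ be nonempty subsets of $R$. Then $$|BA+C|\gg \min \left\{q^{r}, \frac{|A||B||C|}{q^{2r-1}}\right\}.$$ In particular, $$|AA+A|\gg \min\left\{q^{r}, \frac{|A|^3}{q^{2r-1}}\right\},$$ so that if $|A|>q^{r-\frac{1}{3}}$, then $|AA+A|\gg q^{r}$.
   Context: A finite valuation ring is a finite commutative ring with identity that is local and principal (every ideal is principal). Saying that $R$ is a finite valuation ring of order $q^r$ means that the residue field of $R$ (the quotient by its maximal ideal) has $q$ elements, that $r\ge 1$ is the nilpotency index of the maximal ideal (the least $r$ such that its $r$-th power is zero), and hence $|R|=q^r$. For nonempty $X,Y\subset R$: $X+Y=\{x+y: x\in X, y\in Y\}$ and $XY=\{xy: x\in X,y\in Y\}$. Thus $BA+C=\{ba+c: b\in B, a\in A, c\in C\}$. $X\ll Y$ means there is an absolute constant $c>0$ (independent of $R$, $q$, $r$ and all the sets involved) with $X\le cY$; $X\gg Y$ means $Y\ll X$. -}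

module Defs where

open import Algebra.Bundles using (CommutativeRing)
import Algebra.Properties.Ring as RingProperties
import Algebra.Properties.CommutativeMonoid.Sum as Summation
open import Data.Fin.Base using (Fin)
open import Data.Fin.Properties using (any?; _≟_; nonZeroIndex)
open import Data.Fin.Subset using (Subset; _∈_; _⊆_; ⊤)
open import Data.Fin.Subset.Properties using (_∈?_)
open import Data.Integer.Base using (+_)
open import Data.Nat.Base using (ℕ; zero; suc; _^_; _≤_; NonZero)
open import Data.Nat.Properties using (m^n≢0)
open import Data.Product.Base using (_×_; _,_; ∃; ∃₂; proj₁; proj₂)
open import Data.Product using (∃!)
open import Data.Rational.Base using (ℚ; _/_)
open import Data.Sum.Base using (_⊎_)
import Data.Unit.Polymorphic as Unit
open import Data.Vec.Base using (tabulate)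
open import Function.Bundles using (Inverse; _⇔_)
open import Level using (Level; _⊔_) renaming (suc to lsuc)
open import Relation.Binary.Bundles using (Setoid)
open import Relation.Binary.PropositionalEquality.Core using (_≡_; _≢_)
open import Relation.Binary.PropositionalEquality.Properties using (setoid)
import Relation.Binary.Reasoning.Setoid as SetoidReasoning
open import Relation.Nullary.Decidable using (does; _×-dec_)
open import Relation.Unary using (Pred; Decidable)

⌜_⌝ : ℕ → ℚ
⌜ n ⌝ = + n / 1

HasCardinality : ∀ {a ℓ} → Setoid a ℓ → ℕ → Set (a ⊔ ℓ)
HasCardinality S n = Inverse (setoid (Fin n)) S

record FiniteRing (a ℓ : Level) : Set (lsuc (a ⊔ ℓ)) where
  field
    commutativeRing : CommutativeRing a ℓ
    size            : ℕ
    enumeration     : HasCardinality (CommutativeRing.setoid commutativeRing) size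

  private
    module R = CommutativeRing commutativeRing
  open R using (Carrier; _≈_; _+_; _*_; _-_; -_; 0#; 1#)
  open Inverse enumeration public
    using () renaming (to to element; from to index; from-cong to index-cong)
  open Summation R.+-commutativeMonoid using (sum)

  -- A subset of the ring is a subset of the indices of its elements; this
  -- makes membership decidable, and equality of subsets is _≡_.
  RSubset : Set
  RSubset = Subset size

  infix 4 _∈ᴿ_
  _∈ᴿ_ : Carrier → RSubset → Set
  x ∈ᴿ X = index x ∈ X

  ⟦_⟧ : ∀ {p} {P : Pred (Fin size) p} → Decidable P → RSubset
  ⟦ P? ⟧ = tabulate (λ i → does (P? i))

  -- { f x y : x ∈ X, y ∈ Y }
  image₂ : (Carrier → Carrier → Carrier) → RSubset → RSubset → RSubset
  image₂ f X Y = ⟦ (λ k → any? λ i → any? λ j →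
    (i ∈? X) ×-dec (j ∈? Y) ×-dec (k ≟ index (f (element i) (element j)))) ⟧

  infixl 6 _⟨+⟩_
  infixl 7 _⟨*⟩_
  _⟨+⟩_ _⟨*⟩_ : RSubset → RSubset → RSubset
  _⟨+⟩_ = image₂ _+_
  _⟨*⟩_ = image₂ _*_

  record IsIdeal (I : RSubset) : Set a where
    field
      0-mem    : 0# ∈ᴿ I
      +-closed : ∀ {x y} → x ∈ᴿ I → y ∈ᴿ I → x + y ∈ᴿ I
      *-absorb : ∀ x {y} → y ∈ᴿ I → x * y ∈ᴿ I

  IsPrincipal : RSubset → Set (a ⊔ ℓ)
  IsPrincipal I = ∃ λ g → ∀ x → x ∈ᴿ I ⇔ (∃ λ y → x ≈ y * g)

  record IsMaximal (M : RSubset) : Set a where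
    field
      isIdeal : IsIdeal M
      proper  : M ≢ ⊤
      maximal : ∀ I → IsIdeal I → M ⊆ I → I ≡ M ⊎ I ≡ ⊤

  -- The ideal product I J is the set of finite sums of products x y with
  -- x ∈ I and y ∈ J.
  infixr 8 _^ᴵ_
  _^ᴵ_ : RSubset → ℕ → Pred Carrier (a ⊔ ℓ)
  (I ^ᴵ zero)  _ = Unit.⊤
  (I ^ᴵ suc k) z = ∃ λ n → ∃₂ λ (x y : Fin n → Carrier) →
    (∀ i → x i ∈ᴿ I) × (∀ i → (I ^ᴵ k) (y i)) × z ≈ sum (λ i → x i * y i)

  IsZeroIdeal : Pred Carrier (a ⊔ ℓ) → Set (a ⊔ ℓ)
  IsZeroIdeal I = ∀ {x} → I x → x ≈ 0#

  quotient : ∀ {I} → IsIdeal I → Setoid a _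
  quotient {I} isIdeal = record
    { Carrier       = Carrier
    ; _≈_           = λ x y → x - y ∈ᴿ I
    ; isEquivalence = record
      { refl  = λ {x} → resp (R.sym (R.-‿inverseʳ x)) 0-mem
      ; sym   = λ {x} {y} x-y∈I → resp (negate x y) (*-absorb (- 1#) x-y∈I)
      ; trans = λ {x} {y} {z} x-y∈I y-z∈I → resp (glue x y z) (+-closed x-y∈I y-z∈I)
      }
    }
    where
    open IsIdeal isIdeal
    open RingProperties R.ring
    open SetoidReasoning R.setoid

    resp : ∀ {x y} → x ≈ y → x ∈ᴿ I → y ∈ᴿ I
    resp x≈y x∈I rewrite index-cong x≈y = x∈I

    negate : ∀ x y → - 1# * (x - y) ≈ y - x
    negate x y = begin
      - 1# * (x - y)  ≈⟨ -1*x≈-x (x - y) ⟩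
      - (x - y)       ≈⟨ -‿+-comm x (- y) ⟨
      - x + - - y     ≈⟨ R.+-congˡ (-‿involutive y) ⟩
      - x + y         ≈⟨ R.+-comm (- x) y ⟩
      y - x           ∎

    glue : ∀ x y z → (x - y) + (y - z) ≈ x - z
    glue x y z = begin
      (x - y) + (y - z)    ≈⟨ R.+-assoc x (- y) (y - z) ⟩
      x + (- y + (y - z))  ≈⟨ R.+-congˡ (R.+-assoc (- y) y (- z)) ⟨
      x + ((- y + y) - z)  ≈⟨ R.+-congˡ (R.+-congʳ (R.-‿inverseˡ y)) ⟩
      x + (0# - z)         ≈⟨ R.+-congˡ (R.+-identityˡ (- z)) ⟩
      x - z                ∎

record IsFiniteValuationRing {a ℓ} (R : FiniteRing a ℓ) (q r : ℕ) : Set (a ⊔ ℓ) where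
  open FiniteRing R
  field
    principal : ∀ I → IsIdeal I → IsPrincipal I
    local     : ∃! _≡_ IsMaximal

  𝔪 : RSubset
  𝔪 = proj₁ local

  𝔪-isIdeal : IsIdeal 𝔪
  𝔪-isIdeal = IsMaximal.isIdeal (proj₁ (proj₂ local))

  field
    residueField-size : HasCardinality (quotient 𝔪-isIdeal) q
    r≥1               : 1 ≤ r
    𝔪^r-zero          : IsZeroIdeal (𝔪 ^ᴵ r)
    r-least           : ∀ k → IsZeroIdeal (𝔪 ^ᴵ k) → r ≤ k

  q^-nonZero : ∀ k → NonZero (q ^ k)
  q^-nonZero k = m^n≢0 q k {{nonZeroIndex (Inverse.from residueField-size 0#)}}
    where open CommutativeRing commutativeRing using (0#)

{-# OPTIONS --safe #-}

-- Put D = BA + C and let f (b , c) be the number of x ∈ A with b x + c ∈ D. It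
-- has mean |A||D| / |R| over R × R, but equals |A| on B × C, so if |D| ≤ |R| / 2
-- then its variance is at least |B||C||A|² / 4. The second moment counts pairs
-- x , y ∈ A: if y − x is a unit, then (b , c) ↦ (b x + c , b y + c) is a
-- bijection of R × R and the pair contributes |D|²; the at most |A||𝔪| other
-- pairs contribute at most |R||D| each. So the sum of squared deviations is at
-- most |A||D||𝔪||R|. Finally, π-adic expansions, with 𝔪 = (π), give
-- |R| = q ^ r and |𝔪| ≤ q ^ (r − 1).

module Submission where

open import Defs
open import Algebra.Bundles using (CommutativeRing)
import Algebra.Properties.CommutativeMonoid.Sum as Summation
import Algebra.Properties.CommutativeSemiring.Exp as Exponentiation
import Algebra.Properties.Group as GroupProperties
import Algebra.Properties.Ring as RingProperties
import Algebra.Properties.Semiring.Sum as SemiringSummation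
import Algebra.Solver.Ring.NaturalCoefficients.Default as SemiringSolver
open import Data.Bool.Base using (Bool; true; false)
open import Data.Fin.Base using (Fin; zero; suc; combine; remQuot)
open import Data.Fin.Permutation using (permutation)
open import Data.Fin.Properties
  using (any?; _≟_; injective⇒≤; remQuot-combine; combine-surjective)
open import Data.Fin.Subset using (Subset; ∣_∣; Nonempty; _∈_; _⊆_; ⁅_⁆; ⊤)
open import Data.Fin.Subset.Properties using (_∈?_; ∣p∣≤n; ∣⁅x⁆∣≡1; x∈⁅x⁆; ∈⊤)
open import Data.Integer.Base using (+_)
import Data.Integer.Base as ℤ
import Data.Integer.Properties as ℤ
open import Data.Nat.Base
  using (ℕ; zero; suc; _^_; _∸_; _<_; z≤n; NonZero; ≢-nonZero; >-nonZero)
  renaming (_+_ to _+ℕ_; _*_ to _*ℕ_; _≤_ to _≤ℕ_)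
import Data.Nat.Properties as ℕ
open import Data.Nat.Tactic.RingSolver using (solve-∀)
open import Data.Product.Base using (_×_; ∃; _,_; proj₁; proj₂)
import Data.Rational.Properties as ℚ
import Data.Rational.Unnormalised.Base as ℚᵘ
import Data.Rational.Unnormalised.Properties as ℚᵘ
open import Data.Sum.Base as Sum using (_⊎_; inj₁; inj₂; reduce)
import Data.Unit.Polymorphic as Unit
open import Data.Vec.Base using (lookup; []; _∷_)
open import Data.Vec.Properties using (lookup∘tabulate; []=⇒lookup; lookup⇒[]=)
open import Function.Base using (_∘_)
open import Function.Bundles using (Inverse; Equivalence)
open import Level using (Level)
open import Relation.Binary.Bundles using (Setoid)
open import Relation.Binary.PropositionalEquality
  using (_≡_; refl; sym; trans; cong; cong₂; subst; module ≡-Reasoning)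
import Relation.Binary.Reasoning.Setoid as SetoidReasoning
open import Relation.Nullary.Decidable using (Dec; yes; no; does; dec-true; from-yes; _×-dec_)
open import Relation.Nullary.Negation using (¬_; contradiction)
open import Relation.Unary using (Pred; Decidable)

open SemiringSummation ℕ.+-*-semiring
  using (sum; sum-cong-≗; ∑-distrib-+; ∑-comm; sum-permute; *-distribˡ-sum; *-distribʳ-sum)

-- Finite sums of naturals and cardinalities of subsets.

sum-mono-≤ : ∀ {n} {f g : Fin n → ℕ} → (∀ i → f i ≤ℕ g i) → sum f ≤ℕ sum g
sum-mono-≤ {zero}  f≤g = z≤n
sum-mono-≤ {suc n} f≤g = ℕ.+-mono-≤ (f≤g zero) (sum-mono-≤ (f≤g ∘ suc))

sum-const : ∀ n x → sum {n} (λ _ → x) ≡ n *ℕ x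
sum-const zero    x = refl
sum-const (suc n) x = cong (x +ℕ_) (sum-const n x)

term≤sum : ∀ {n} (f : Fin n → ℕ) i → f i ≤ℕ sum f
term≤sum f zero    = ℕ.m≤m+n _ _
term≤sum f (suc i) = ℕ.≤-trans (term≤sum (f ∘ suc) i) (ℕ.m≤n+m _ _)

𝟙 : Bool → ℕ
𝟙 true  = 1
𝟙 false = 0

𝟙≤1 : ∀ b → 𝟙 b ≤ℕ 1
𝟙≤1 true  = ℕ.≤-refl
𝟙≤1 false = z≤n

∣X∣≡sum : ∀ {n} (X : Subset n) → ∣ X ∣ ≡ sum (𝟙 ∘ lookup X)
∣X∣≡sum []          = refl
∣X∣≡sum (true  ∷ X) = cong suc (∣X∣≡sum X)
∣X∣≡sum (false ∷ X) = ∣X∣≡sum X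

-- Double counting: every element of `X` lies in some singleton `⁅ h j ⁆`, and each of the `k`
-- singletons contributes exactly 1.
∣X∣≤covering : ∀ {k n} (X : Subset n) (h : Fin k → Fin n) →
  (∀ {i} → i ∈ X → ∃ λ j → h j ≡ i) → ∣ X ∣ ≤ℕ k
∣X∣≤covering {k} {n} X h covers = begin
  ∣ X ∣                                         ≡⟨ ∣X∣≡sum X ⟩
  sum (𝟙 ∘ lookup X)                            ≤⟨ sum-mono-≤ hit ⟩
  sum (λ i → sum (λ j → 𝟙 (lookup ⁅ h j ⁆ i)))  ≡⟨ ∑-comm (λ i j → 𝟙 (lookup ⁅ h j ⁆ i)) ⟩
  sum (λ j → sum (𝟙 ∘ lookup ⁅ h j ⁆))          ≡⟨ sum-cong-≗ singleton ⟩
  sum {k} (λ _ → 1)                             ≡⟨ trans (sum-const k 1) (ℕ.*-identityʳ k) ⟩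
  k                                             ∎
  where
  singleton : ∀ j → sum (𝟙 ∘ lookup ⁅ h j ⁆) ≡ 1
  singleton j = trans (sym (∣X∣≡sum ⁅ h j ⁆)) (∣⁅x⁆∣≡1 (h j))
  open ℕ.≤-Reasoning
  hit : ∀ i → 𝟙 (lookup X i) ≤ℕ sum (λ j → 𝟙 (lookup ⁅ h j ⁆ i))
  hit i with i ∈? X
  ... | yes i∈X with j , refl ← covers i∈X = begin
    𝟙 (lookup X (h j))           ≤⟨ 𝟙≤1 _ ⟩
    1                            ≡⟨ cong 𝟙 ([]=⇒lookup (x∈⁅x⁆ (h j))) ⟨
    𝟙 (lookup ⁅ h j ⁆ (h j))     ≤⟨ term≤sum (λ j′ → 𝟙 (lookup ⁅ h j′ ⁆ (h j))) j ⟩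
    _                            ∎
  ... | no i∉X with lookup X i in eq
  ...   | true  = contradiction (lookup⇒[]= i X eq) i∉X
  ...   | false = z≤n

-- The two sides differ by the square of `k = |x - y|`; ordering the arguments first keeps
-- everything in the naturals.
2xy≤x²+y² : ∀ x y → 2 *ℕ (x *ℕ y) ≤ℕ x *ℕ x +ℕ y *ℕ y
2xy≤x²+y² x y with ℕ.≤-total x y
... | inj₁ x≤y with k , refl ← ℕ.m≤n⇒∃[o]m+o≡n x≤y =
  ℕ.m+n≤o⇒m≤o _ (ℕ.≤-reflexive (square x k))
  where
  square : ∀ x k → 2 *ℕ (x *ℕ (x +ℕ k)) +ℕ k *ℕ k ≡ x *ℕ x +ℕ (x +ℕ k) *ℕ (x +ℕ k)
  square = solve-∀
... | inj₂ y≤x with k , refl ← ℕ.m≤n⇒∃[o]m+o≡n y≤x =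
  ℕ.m+n≤o⇒m≤o _ (ℕ.≤-reflexive (square y k))
  where
  square : ∀ y k → 2 *ℕ ((y +ℕ k) *ℕ y) +ℕ k *ℕ k ≡ (y +ℕ k) *ℕ (y +ℕ k) +ℕ y *ℕ y
  square = solve-∀

-- Finite rings: membership in subsets and in image sets.

module FiniteRingProperties {a ℓ} (R : FiniteRing a ℓ) where
  open FiniteRing R
  open CommutativeRing commutativeRing public
    using (Carrier; _≈_; _+_; _*_; _-_; -_; 0#; 1#)
  module R = CommutativeRing commutativeRing
  open GroupProperties R.+-group using (//-rightDividesˡ; //-rightDividesʳ)
  open RingProperties R.ring using (x[y-z]≈xy-xz)

  element-index : ∀ x → element (index x) ≈ x
  element-index = Inverse.strictlyInverseˡ enumeration

  index-element : ∀ i → index (element i) ≡ i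
  index-element = Inverse.strictlyInverseʳ enumeration

  ∈ᴿ-resp-≈ : ∀ {X x y} → x ≈ y → x ∈ᴿ X → y ∈ᴿ X
  ∈ᴿ-resp-≈ {X} x≈y = subst (_∈ X) (index-cong x≈y)

  ∈⟦⟧⁺ : ∀ {p} {P : Pred (Fin size) p} (P? : Decidable P) {i} → P i → i ∈ ⟦ P? ⟧
  ∈⟦⟧⁺ P? {i} Pi = lookup⇒[]= i _ (trans (lookup∘tabulate _ i) (dec-true (P? i) Pi))

  ∈⟦⟧⁻ : ∀ {p} {P : Pred (Fin size) p} (P? : Decidable P) {i} → i ∈ ⟦ P? ⟧ → P i
  ∈⟦⟧⁻ P? {i} i∈ with P? i | trans (sym (lookup∘tabulate (λ j → does (P? j)) i)) ([]=⇒lookup i∈)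
  ... | yes Pi | _  = Pi
  ... | no  _  | ()

  Congruent₂ : (Carrier → Carrier → Carrier) → Set _
  Congruent₂ f = ∀ {x x′ y y′} → x ≈ x′ → y ≈ y′ → f x y ≈ f x′ y′

  -- The decision procedure inside `image₂`, restated so that `∈⟦⟧⁺` and `∈⟦⟧⁻` can be instantiated
  -- with it.
  ∈image₂? : ∀ (f : Carrier → Carrier → Carrier) X Y → Decidable (λ k →
    ∃ λ (i : Fin size) → ∃ λ (j : Fin size) →
    i ∈ X × j ∈ Y × k ≡ index (f (element i) (element j)))
  ∈image₂? f X Y k = any? λ i → any? λ j →
    (i ∈? X) ×-dec (j ∈? Y) ×-dec (k ≟ index (f (element i) (element j)))

  image₂⁺ : ∀ {f X Y x y} → Congruent₂ f → x ∈ᴿ X → y ∈ᴿ Y → f x y ∈ᴿ image₂ f X Y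
  image₂⁺ {f} {X} {Y} f-cong x∈X y∈Y = ∈⟦⟧⁺ (∈image₂? f X Y)
    (_ , _ , x∈X , y∈Y ,
     index-cong (f-cong (R.sym (element-index _)) (R.sym (element-index _))))

  image₂⁻ : ∀ {f X Y z} → z ∈ᴿ image₂ f X Y → ∃ λ x → ∃ λ y → x ∈ᴿ X × y ∈ᴿ Y × z ≈ f x y
  image₂⁻ {f} {X} {Y} {z} z∈ with i , j , i∈X , j∈Y , eq ← ∈⟦⟧⁻ (∈image₂? f X Y) z∈ =
    element i , element j ,
    subst (_∈ X) (sym (index-element i)) i∈X ,
    subst (_∈ Y) (sym (index-element j)) j∈Y ,
    R.trans (R.sym (element-index z))
      (R.trans (R.reflexive (cong element eq)) (element-index _))

  -- Sums over all ring elements and their invariance.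

  ∑ : (Carrier → ℕ) → ℕ
  ∑ F = sum (F ∘ element)

  Respectful : (Carrier → ℕ) → Set _
  Respectful F = ∀ {x y} → x ≈ y → F x ≡ F y

  χ : RSubset → Carrier → ℕ
  χ X x = 𝟙 (lookup X (index x))

  χ-cong : ∀ X → Respectful (χ X)
  χ-cong X x≈y = cong (𝟙 ∘ lookup X) (index-cong x≈y)

  χ-∈ : ∀ {X x} → x ∈ᴿ X → χ X x ≡ 1
  χ-∈ x∈X = cong 𝟙 ([]=⇒lookup x∈X)

  ∑-χ : ∀ X → ∑ (χ X) ≡ ∣ X ∣
  ∑-χ X = trans (sum-cong-≗ (λ i → cong (𝟙 ∘ lookup X) (index-element i))) (sym (∣X∣≡sum X))

  ∑-const : ∀ x → ∑ (λ _ → x) ≡ size *ℕ x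
  ∑-const = sum-const size

  χ≤1 : ∀ X x → χ X x ≤ℕ 1
  χ≤1 X x = 𝟙≤1 (lookup X (index x))

  ∑-cong : ∀ {F G} → (∀ x → F x ≡ G x) → ∑ F ≡ ∑ G
  ∑-cong F≗G = sum-cong-≗ (F≗G ∘ element)

  ∑-mono-≤ : ∀ {F G} → (∀ x → F x ≤ℕ G x) → ∑ F ≤ℕ ∑ G
  ∑-mono-≤ F≤G = sum-mono-≤ (F≤G ∘ element)

  ∑-+ : ∀ F G → ∑ (λ x → F x +ℕ G x) ≡ ∑ F +ℕ ∑ G
  ∑-+ F G = ∑-distrib-+ (F ∘ element) (G ∘ element)

  ∑-*ˡ : ∀ k F → ∑ (λ x → k *ℕ F x) ≡ k *ℕ ∑ F
  ∑-*ˡ k F = sym (*-distribˡ-sum k (F ∘ element))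

  ∑-*ʳ : ∀ k F → ∑ (λ x → F x *ℕ k) ≡ ∑ F *ℕ k
  ∑-*ʳ k F = sym (*-distribʳ-sum k (F ∘ element))

  ∑-swap : ∀ (F : Carrier → Carrier → ℕ) → ∑ (λ x → ∑ (F x)) ≡ ∑ (λ y → ∑ (λ x → F x y))
  ∑-swap F = ∑-comm (λ i j → F (element i) (element j))

  -- `to` and `from` are inverse only up to `≈`; transported to indices they become a permutation of
  -- `Fin size`.
  ∑-reindex : ∀ {F} (to from : Carrier → Carrier) → Respectful F →
    (∀ {x y} → x ≈ y → to x ≈ to y) → (∀ {x y} → x ≈ y → from x ≈ from y) →
    (∀ x → to (from x) ≈ x) → (∀ x → from (to x) ≈ x) →
    ∑ (F ∘ to) ≡ ∑ F
  ∑-reindex {F} to from F-cong to-cong from-cong to-from from-to =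
    sym (trans (sum-permute (F ∘ element) π)
               (sum-cong-≗ (λ i → F-cong (element-index (to (element i))))))
    where
    π = permutation (index ∘ to ∘ element) (index ∘ from ∘ element)
      (λ i → trans (index-cong (R.trans (to-cong (element-index _)) (to-from _))) (index-element i))
      (λ i → trans (index-cong (R.trans (from-cong (element-index _)) (from-to _))) (index-element i))

  ∑-translate : ∀ {F} t → Respectful F → ∑ (λ x → F (x + t)) ≡ ∑ F
  ∑-translate t F-cong = ∑-reindex (_+ t) (_- t) F-cong R.+-congʳ R.+-congʳ
    (//-rightDividesˡ t) (//-rightDividesʳ t)

  Invertible : Carrier → Set _
  Invertible u = ∃ λ v → u * v ≈ 1#

  ∑-scale : ∀ {F u} → Invertible u → Respectful F → ∑ (λ x → F (x * u)) ≡ ∑ F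
  ∑-scale {u = u} (v , uv≈1) F-cong = ∑-reindex (_* u) (_* v) F-cong R.*-congʳ R.*-congʳ
    (cancel (R.trans (R.*-comm v u) uv≈1)) (cancel uv≈1)
    where
    cancel : ∀ {y z} → y * z ≈ 1# → ∀ x → x * y * z ≈ x
    cancel yz≈1 x = R.trans (R.*-assoc x _ _) (R.trans (R.*-congˡ yz≈1) (R.*-identityʳ x))

  -- With `c + b * x` as the new variable in place of `c`, the value at `x` is the variable itself
  -- and the value at `y` exceeds it by `b * (y - x)`.
  line-through : ∀ x y b c → b * y + c ≈ b * (y - x) + (c + b * x)
  line-through x y b c = R.sym (begin
    b * (y - x) + (c + b * x)          ≈⟨ R.+-cong (x[y-z]≈xy-xz b y x) (R.+-comm c (b * x)) ⟩
    (b * y - b * x) + (b * x + c)      ≈⟨ R.+-assoc (b * y - b * x) (b * x) c ⟨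
    (b * y - b * x) + b * x + c        ≈⟨ R.+-congʳ (//-rightDividesˡ (b * x) (b * y)) ⟩
    b * y + c                          ∎)
    where open SetoidReasoning R.setoid

  -- Incidences of lines with `A × D`: first and second moments.

  module Incidences (U : RSubset) (∉U⇒invertible : ∀ u → ¬ (u ∈ᴿ U) → Invertible u)
                    (A D : RSubset) where

    private
      n = size
      m = ∣ U ∣
      α = ∣ A ∣
      δ = ∣ D ∣

    -- The number of points of `A × D` on the line with slope `b` and intercept `c`.
    line : Carrier → Carrier → ℕ
    line b c = ∑ (λ x → χ A x *ℕ χ D (b * x + c))

    -- The number of lines whose values at `x` and at `y` both lie in `D`.
    common : Carrier → Carrier → ℕ
    common x y = ∑ (λ b → ∑ (λ c → χ D (b * x + c) *ℕ χ D (b * y + c)))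

    ∑-χ-line : ∀ t → ∑ (λ c → χ D (t + c)) ≡ δ
    ∑-χ-line t = begin
      ∑ (λ c → χ D (t + c))  ≡⟨ ∑-cong (λ c → χ-cong D (R.+-comm t c)) ⟩
      ∑ (λ c → χ D (c + t))  ≡⟨ ∑-translate t (χ-cong D) ⟩
      ∑ (χ D)                ≡⟨ ∑-χ D ⟩
      δ                      ∎
      where open ≡-Reasoning

    common-≤-trivial : ∀ x y → common x y ≤ℕ n *ℕ δ
    common-≤-trivial x y = begin
      common x y
        ≤⟨ ∑-mono-≤ (λ b → ∑-mono-≤ {G = λ c → χ D (b * x + c) *ℕ 1}
             (λ c → ℕ.*-monoʳ-≤ (χ D (b * x + c)) (χ≤1 D (b * y + c)))) ⟩
      ∑ (λ b → ∑ (λ c → χ D (b * x + c) *ℕ 1))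
        ≡⟨ ∑-cong (λ b → ∑-cong (λ c → ℕ.*-identityʳ (χ D (b * x + c)))) ⟩
      ∑ (λ b → ∑ (λ c → χ D (b * x + c)))
        ≡⟨ ∑-cong (λ b → ∑-χ-line (b * x)) ⟩
      ∑ (λ b → δ)
        ≡⟨ ∑-const δ ⟩
      n *ℕ δ ∎
      where open ℕ.≤-Reasoning

    -- After shifting `c` by `b * x` the first factor depends on `c` alone; for fixed `c`, the map
    -- sending `b` to `b * (y - x) + c` permutes the ring, so each factor sums to `δ`.
    common-invertible : ∀ x y → Invertible (y - x) → common x y ≡ δ *ℕ δ
    common-invertible x y inv = begin
      common x y
        ≡⟨ ∑-cong (λ b → shift b) ⟩
      ∑ (λ b → ∑ (λ c → χ D c *ℕ χ D (b * (y - x) + c)))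
        ≡⟨ ∑-swap (λ b c → χ D c *ℕ χ D (b * (y - x) + c)) ⟩
      ∑ (λ c → ∑ (λ b → χ D c *ℕ χ D (b * (y - x) + c)))
        ≡⟨ ∑-cong (λ c → ∑-*ˡ (χ D c) (λ b → χ D (b * (y - x) + c))) ⟩
      ∑ (λ c → χ D c *ℕ ∑ (λ b → χ D (b * (y - x) + c)))
        ≡⟨ ∑-cong (λ c → cong (χ D c *ℕ_) (column c)) ⟩
      ∑ (λ c → χ D c *ℕ δ)
        ≡⟨ trans (∑-*ʳ δ (χ D)) (cong (_*ℕ δ) (∑-χ D)) ⟩
      δ *ℕ δ ∎
      where
      open ≡-Reasoning
      column : ∀ c → ∑ (λ b → χ D (b * (y - x) + c)) ≡ δ
      column c = begin
        ∑ (λ b → χ D (b * (y - x) + c))  ≡⟨ ∑-scale inv (λ p → χ-cong D (R.+-congʳ p)) ⟩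
        ∑ (λ b → χ D (b + c))            ≡⟨ ∑-translate c (χ-cong D) ⟩
        ∑ (χ D)                          ≡⟨ ∑-χ D ⟩
        δ                                ∎
      shift : ∀ b → ∑ (λ c → χ D (b * x + c) *ℕ χ D (b * y + c)) ≡
                    ∑ (λ c → χ D c *ℕ χ D (b * (y - x) + c))
      shift b = begin
        ∑ (λ c → χ D (b * x + c) *ℕ χ D (b * y + c))
          ≡⟨ ∑-cong (λ c → cong₂ _*ℕ_ (χ-cong D (R.+-comm (b * x) c)) (χ-cong D (line-through x y b c))) ⟩
        ∑ (λ c → χ D (c + b * x) *ℕ χ D (b * (y - x) + (c + b * x)))
          ≡⟨ ∑-translate (b * x) (λ p → cong₂ _*ℕ_ (χ-cong D p) (χ-cong D (R.+-congˡ p))) ⟩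
        ∑ (λ c → χ D c *ℕ χ D (b * (y - x) + c)) ∎

    common-≤ : ∀ x y → common x y ≤ℕ δ *ℕ δ +ℕ χ U (y - x) *ℕ (n *ℕ δ)
    common-≤ x y with index (y - x) ∈? U
    ... | yes ∈U rewrite χ-∈ {U} {y - x} ∈U | ℕ.+-identityʳ (n *ℕ δ) =
      ℕ.≤-trans (common-≤-trivial x y) (ℕ.m≤n+m _ _)
    ... | no  ∉U =
      ℕ.≤-trans (ℕ.≤-reflexive (common-invertible x y (∉U⇒invertible _ ∉U))) (ℕ.m≤m+n _ _)

    -- For fixed `b` and `x`, exactly `δ` values of `c` put `b * x + c` in `D`.
    line-total : ∑ (λ b → ∑ (λ c → line b c)) ≡ n *ℕ (α *ℕ δ)
    line-total = begin
      ∑ (λ b → ∑ (λ c → line b c))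
        ≡⟨ ∑-cong (λ b → ∑-swap (λ c x → χ A x *ℕ χ D (b * x + c))) ⟩
      ∑ (λ b → ∑ (λ x → ∑ (λ c → χ A x *ℕ χ D (b * x + c))))
        ≡⟨ ∑-cong (λ b → ∑-cong (λ x → ∑-*ˡ (χ A x) (λ c → χ D (b * x + c)))) ⟩
      ∑ (λ b → ∑ (λ x → χ A x *ℕ ∑ (λ c → χ D (b * x + c))))
        ≡⟨ ∑-cong (λ b → ∑-cong (λ x → cong (χ A x *ℕ_) (∑-χ-line (b * x)))) ⟩
      ∑ (λ b → ∑ (λ x → χ A x *ℕ δ))
        ≡⟨ ∑-cong (λ b → trans (∑-*ʳ δ (χ A)) (cong (_*ℕ δ) (∑-χ A))) ⟩
      ∑ (λ b → α *ℕ δ)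
        ≡⟨ ∑-const (α *ℕ δ) ⟩
      n *ℕ (α *ℕ δ) ∎
      where open ≡-Reasoning

    line-square : ∀ b c → line b c *ℕ line b c ≡
      ∑ (λ x → ∑ (λ y → χ A x *ℕ χ A y *ℕ (χ D (b * x + c) *ℕ χ D (b * y + c))))
    line-square b c = begin
      line b c *ℕ line b c
        ≡⟨ ∑-*ʳ (line b c) (λ x → χ A x *ℕ χ D (b * x + c)) ⟨
      ∑ (λ x → χ A x *ℕ χ D (b * x + c) *ℕ line b c)
        ≡⟨ ∑-cong (λ x → ∑-*ˡ (χ A x *ℕ χ D (b * x + c)) (λ y → χ A y *ℕ χ D (b * y + c))) ⟨
      ∑ (λ x → ∑ (λ y → χ A x *ℕ χ D (b * x + c) *ℕ (χ A y *ℕ χ D (b * y + c))))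
        ≡⟨ ∑-cong (λ x → ∑-cong (λ y → regroup (χ A x) (χ D (b * x + c)) (χ A y) (χ D (b * y + c)))) ⟩
      _ ∎
      where
      open ≡-Reasoning
      regroup : ∀ p q r s → p *ℕ q *ℕ (r *ℕ s) ≡ p *ℕ r *ℕ (q *ℕ s)
      regroup = solve-∀

    -- Expanding the square gives a sum over pairs of points; exchanging the four sums moves the
    -- pair `x`, `y` outside.
    line-square-total : ∑ (λ b → ∑ (λ c → line b c *ℕ line b c)) ≡
      ∑ (λ x → ∑ (λ y → χ A x *ℕ χ A y *ℕ common x y))
    line-square-total = begin
      ∑ (λ b → ∑ (λ c → line b c *ℕ line b c))
        ≡⟨ ∑-cong (λ b → ∑-cong (line-square b)) ⟩
      ∑ (λ b → ∑ (λ c → ∑ (λ x → ∑ (λ y → G b c x y))))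
        ≡⟨ ∑-cong (λ b → ∑-swap (λ c x → ∑ (G b c x))) ⟩
      ∑ (λ b → ∑ (λ x → ∑ (λ c → ∑ (λ y → G b c x y))))
        ≡⟨ ∑-swap (λ b x → ∑ (λ c → ∑ (G b c x))) ⟩
      ∑ (λ x → ∑ (λ b → ∑ (λ c → ∑ (λ y → G b c x y))))
        ≡⟨ ∑-cong (λ x → ∑-cong (λ b → ∑-swap (λ c y → G b c x y))) ⟩
      ∑ (λ x → ∑ (λ b → ∑ (λ y → ∑ (λ c → G b c x y))))
        ≡⟨ ∑-cong (λ x → ∑-swap (λ b y → ∑ (λ c → G b c x y))) ⟩
      ∑ (λ x → ∑ (λ y → ∑ (λ b → ∑ (λ c → G b c x y))))
        ≡⟨ ∑-cong (λ x → ∑-cong (λ y → trans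
             (∑-cong (λ b → ∑-*ˡ (χ A x *ℕ χ A y) (λ c → χ D (b * x + c) *ℕ χ D (b * y + c))))
             (∑-*ˡ (χ A x *ℕ χ A y) (λ b → ∑ (λ c → χ D (b * x + c) *ℕ χ D (b * y + c)))))) ⟩
      ∑ (λ x → ∑ (λ y → χ A x *ℕ χ A y *ℕ common x y)) ∎
      where
      open ≡-Reasoning
      G : Carrier → Carrier → Carrier → Carrier → ℕ
      G b c x y = χ A x *ℕ χ A y *ℕ (χ D (b * x + c) *ℕ χ D (b * y + c))

    second-moment : ∑ (λ b → ∑ (λ c → line b c *ℕ line b c)) ≤ℕ
                    α *ℕ (α *ℕ (δ *ℕ δ) +ℕ m *ℕ (n *ℕ δ))
    second-moment = begin
      ∑ (λ b → ∑ (λ c → line b c *ℕ line b c))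
        ≡⟨ line-square-total ⟩
      ∑ (λ x → ∑ (λ y → χ A x *ℕ χ A y *ℕ common x y))
        ≤⟨ ∑-mono-≤ (λ x → ∑-mono-≤ (λ y → bound x y)) ⟩
      ∑ (λ x → ∑ (λ y → χ A x *ℕ (χ A y *ℕ (δ *ℕ δ) +ℕ χ U (y - x) *ℕ (n *ℕ δ))))
        ≡⟨ ∑-cong (λ x → trans
             (∑-*ˡ (χ A x) (λ y → χ A y *ℕ (δ *ℕ δ) +ℕ χ U (y - x) *ℕ (n *ℕ δ)))
             (cong (χ A x *ℕ_) (row x))) ⟩
      ∑ (λ x → χ A x *ℕ (α *ℕ (δ *ℕ δ) +ℕ m *ℕ (n *ℕ δ)))
        ≡⟨ trans (∑-*ʳ W (χ A)) (cong (_*ℕ W) (∑-χ A)) ⟩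
      α *ℕ (α *ℕ (δ *ℕ δ) +ℕ m *ℕ (n *ℕ δ)) ∎
      where
      open ℕ.≤-Reasoning
      W = α *ℕ (δ *ℕ δ) +ℕ m *ℕ (n *ℕ δ)
      bound : ∀ x y → χ A x *ℕ χ A y *ℕ common x y ≤ℕ
                      χ A x *ℕ (χ A y *ℕ (δ *ℕ δ) +ℕ χ U (y - x) *ℕ (n *ℕ δ))
      bound x y = begin
        χ A x *ℕ χ A y *ℕ common x y
          ≡⟨ ℕ.*-assoc (χ A x) (χ A y) (common x y) ⟩
        χ A x *ℕ (χ A y *ℕ common x y)
          ≤⟨ ℕ.*-monoʳ-≤ (χ A x) (ℕ.*-monoʳ-≤ (χ A y) (common-≤ x y)) ⟩
        χ A x *ℕ (χ A y *ℕ (δ *ℕ δ +ℕ E))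
          ≡⟨ cong (χ A x *ℕ_) (ℕ.*-distribˡ-+ (χ A y) (δ *ℕ δ) E) ⟩
        χ A x *ℕ (χ A y *ℕ (δ *ℕ δ) +ℕ χ A y *ℕ E)
          -- Forgetting in the error term that `y` lies in `A` lets the later sum over `y` run over
          -- a full translate of `U`, which is where `m` comes from.
          ≤⟨ ℕ.*-monoʳ-≤ (χ A x) (ℕ.+-monoʳ-≤ (χ A y *ℕ (δ *ℕ δ)) (ℕ.*-monoˡ-≤ E (χ≤1 A y))) ⟩
        χ A x *ℕ (χ A y *ℕ (δ *ℕ δ) +ℕ 1 *ℕ E)
          ≡⟨ cong (λ z → χ A x *ℕ (χ A y *ℕ (δ *ℕ δ) +ℕ z)) (ℕ.*-identityˡ E) ⟩
        χ A x *ℕ (χ A y *ℕ (δ *ℕ δ) +ℕ E) ∎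
        where E = χ U (y - x) *ℕ (n *ℕ δ)
      row : ∀ x → ∑ (λ y → χ A y *ℕ (δ *ℕ δ) +ℕ χ U (y - x) *ℕ (n *ℕ δ)) ≡
                  α *ℕ (δ *ℕ δ) +ℕ m *ℕ (n *ℕ δ)
      row x = trans (∑-+ (λ y → χ A y *ℕ (δ *ℕ δ)) (λ y → χ U (y - x) *ℕ (n *ℕ δ))) (cong₂ _+ℕ_
        (trans (∑-*ʳ (δ *ℕ δ) (χ A)) (cong (_*ℕ (δ *ℕ δ)) (∑-χ A)))
        (trans (∑-*ʳ (n *ℕ δ) (λ y → χ U (y - x)))
               (cong (_*ℕ (n *ℕ δ)) (trans (∑-translate (- x) (χ-cong U)) (∑-χ U)))))

    -- The variance inequality and the dichotomy.

    am-gm : ∀ f → (2 *ℕ n *ℕ (α *ℕ δ)) *ℕ f +ℕ 0 ≤ℕ n *ℕ n *ℕ (f *ℕ f) +ℕ α *ℕ δ *ℕ (α *ℕ δ)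
    am-gm f = begin
      2 *ℕ n *ℕ (α *ℕ δ) *ℕ f +ℕ 0
        ≡⟨ regroup n (α *ℕ δ) f ⟩
      2 *ℕ (n *ℕ f *ℕ (α *ℕ δ))
        ≤⟨ 2xy≤x²+y² (n *ℕ f) (α *ℕ δ) ⟩
      n *ℕ f *ℕ (n *ℕ f) +ℕ α *ℕ δ *ℕ (α *ℕ δ)
        ≡⟨ cong (_+ℕ α *ℕ δ *ℕ (α *ℕ δ)) (ℕ.[m*n]*[o*p]≡[m*o]*[n*p] n f n f) ⟩
      n *ℕ n *ℕ (f *ℕ f) +ℕ α *ℕ δ *ℕ (α *ℕ δ) ∎
      where
      open ℕ.≤-Reasoning
      regroup : ∀ n p f → 2 *ℕ n *ℕ p *ℕ f +ℕ 0 ≡ 2 *ℕ (n *ℕ f *ℕ p)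
      regroup = solve-∀

    -- With f = line b c: (n f − α δ)² ≥ 0, and it equals (α e)² on B × C, all
    -- terms moved so that no subtraction occurs.
    deviation : ∀ B C e → n ≡ δ +ℕ e →
      (∀ {b c} → b ∈ᴿ B → c ∈ᴿ C → line b c ≡ α) → ∀ b c →
      (2 *ℕ n *ℕ (α *ℕ δ)) *ℕ line b c +ℕ χ B b *ℕ χ C c *ℕ (α *ℕ α *ℕ (e *ℕ e)) ≤ℕ
      n *ℕ n *ℕ (line b c *ℕ line b c) +ℕ α *ℕ δ *ℕ (α *ℕ δ)
    deviation B C e n≡δ+e full b c
      with lookup B (index b) in eqB | lookup C (index c) in eqC
    ... | true  | true  =
      ℕ.≤-reflexive (square n≡δ+e (full (lookup⇒[]= _ B eqB) (lookup⇒[]= _ C eqC)))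
      where
      expand : ∀ α δ e →
        (2 *ℕ (δ +ℕ e) *ℕ (α *ℕ δ)) *ℕ α +ℕ 1 *ℕ (α *ℕ α *ℕ (e *ℕ e)) ≡
        (δ +ℕ e) *ℕ (δ +ℕ e) *ℕ (α *ℕ α) +ℕ α *ℕ δ *ℕ (α *ℕ δ)
      expand = solve-∀
      -- `n` and `line b c` are not variables, so both are abstracted before their equations are
      -- matched with `refl`.
      square : ∀ {k f} → k ≡ δ +ℕ e → f ≡ α →
        (2 *ℕ k *ℕ (α *ℕ δ)) *ℕ f +ℕ 1 *ℕ (α *ℕ α *ℕ (e *ℕ e)) ≡
        k *ℕ k *ℕ (f *ℕ f) +ℕ α *ℕ δ *ℕ (α *ℕ δ)
      square refl refl = expand α δ e
    -- Off `B × C` the indicator term computes to 0, which is the `+ℕ 0` in `am-gm`.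
    ... | true  | false = am-gm (line b c)
    ... | false | _     = am-gm (line b c)

    -- The hypothesis `full` makes the deviation from the mean large on `B × C`: in the second case
    -- the gap `e = n - δ` is at least half of `n`.
    dichotomy : ∀ B C → (∀ {b c} → b ∈ᴿ B → c ∈ᴿ C → line b c ≡ α) →
      n ≤ℕ 2 *ℕ δ ⊎ α *ℕ ∣ B ∣ *ℕ ∣ C ∣ ≤ℕ 4 *ℕ (m *ℕ n *ℕ δ)
    dichotomy B C full with ℕ.≤-total n (2 *ℕ δ)
    ... | inj₁ n≤2δ = inj₁ n≤2δ
    ... | inj₂ 2δ≤n with δ≤n ← ℕ.≤-trans (ℕ.m≤m+n δ (1 *ℕ δ)) 2δ≤n
                     with e , δ+e≡n ← ℕ.m≤n⇒∃[o]m+o≡n δ≤n = inj₂ conclusion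
      where
      β = ∣ B ∣
      γ = ∣ C ∣
      -- `K` is the squared deviation of `n` times `line` on `B × C`, and `P` is `n` times the mean
      -- of `line`.
      K = α *ℕ α *ℕ (e *ℕ e)
      P = α *ℕ δ

      total-left : ∑ (λ b → ∑ (λ c → (2 *ℕ n *ℕ P) *ℕ line b c +ℕ χ B b *ℕ χ C c *ℕ K)) ≡
                   (2 *ℕ n *ℕ P) *ℕ (n *ℕ P) +ℕ β *ℕ (γ *ℕ K)
      total-left = begin
        ∑ (λ b → ∑ (λ c → (2 *ℕ n *ℕ P) *ℕ line b c +ℕ χ B b *ℕ χ C c *ℕ K))
          ≡⟨ ∑-cong (λ b → trans
             (∑-+ (λ c → (2 *ℕ n *ℕ P) *ℕ line b c) (λ c → χ B b *ℕ χ C c *ℕ K))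
             (cong₂ _+ℕ_ (∑-*ˡ (2 *ℕ n *ℕ P) (line b)) (block b))) ⟩
        ∑ (λ b → (2 *ℕ n *ℕ P) *ℕ ∑ (line b) +ℕ χ B b *ℕ (γ *ℕ K))
          ≡⟨ trans (∑-+ (λ b → (2 *ℕ n *ℕ P) *ℕ ∑ (line b)) (λ b → χ B b *ℕ (γ *ℕ K)))
                   (cong₂ _+ℕ_ (∑-*ˡ (2 *ℕ n *ℕ P) (λ b → ∑ (line b))) (∑-*ʳ (γ *ℕ K) (χ B))) ⟩
        (2 *ℕ n *ℕ P) *ℕ ∑ (λ b → ∑ (line b)) +ℕ ∑ (χ B) *ℕ (γ *ℕ K)
          ≡⟨ cong₂ (λ s t → (2 *ℕ n *ℕ P) *ℕ s +ℕ t *ℕ (γ *ℕ K)) line-total (∑-χ B) ⟩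
        (2 *ℕ n *ℕ P) *ℕ (n *ℕ P) +ℕ β *ℕ (γ *ℕ K) ∎
        where
        open ≡-Reasoning
        block : ∀ b → ∑ (λ c → χ B b *ℕ χ C c *ℕ K) ≡ χ B b *ℕ (γ *ℕ K)
        block b = begin
          ∑ (λ c → χ B b *ℕ χ C c *ℕ K)    ≡⟨ ∑-cong (λ c → ℕ.*-assoc (χ B b) (χ C c) K) ⟩
          ∑ (λ c → χ B b *ℕ (χ C c *ℕ K))  ≡⟨ ∑-*ˡ (χ B b) (λ c → χ C c *ℕ K) ⟩
          χ B b *ℕ ∑ (λ c → χ C c *ℕ K)    ≡⟨ cong (χ B b *ℕ_) (trans (∑-*ʳ K (χ C)) (cong (_*ℕ K) (∑-χ C))) ⟩
          χ B b *ℕ (γ *ℕ K)                ∎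

      total-right : ∑ (λ b → ∑ (λ c → n *ℕ n *ℕ (line b c *ℕ line b c) +ℕ P *ℕ P)) ≡
                    n *ℕ n *ℕ ∑ (λ b → ∑ (λ c → line b c *ℕ line b c)) +ℕ n *ℕ (n *ℕ (P *ℕ P))
      total-right = begin
        ∑ (λ b → ∑ (λ c → n *ℕ n *ℕ (line b c *ℕ line b c) +ℕ P *ℕ P))
          ≡⟨ ∑-cong (λ b → trans
             (∑-+ (λ c → n *ℕ n *ℕ (line b c *ℕ line b c)) (λ _ → P *ℕ P))
             (cong₂ _+ℕ_ (∑-*ˡ (n *ℕ n) (λ c → line b c *ℕ line b c)) (∑-const (P *ℕ P)))) ⟩
        ∑ (λ b → n *ℕ n *ℕ ∑ (λ c → line b c *ℕ line b c) +ℕ n *ℕ (P *ℕ P))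
          ≡⟨ trans (∑-+ (λ b → n *ℕ n *ℕ ∑ (λ c → line b c *ℕ line b c)) (λ _ → n *ℕ (P *ℕ P)))
                   (cong₂ _+ℕ_ (∑-*ˡ (n *ℕ n) (λ b → ∑ (λ c → line b c *ℕ line b c)))
                               (∑-const (n *ℕ (P *ℕ P)))) ⟩
        n *ℕ n *ℕ ∑ (λ b → ∑ (λ c → line b c *ℕ line b c)) +ℕ n *ℕ (n *ℕ (P *ℕ P)) ∎
        where open ≡-Reasoning

      -- Sum `deviation` over all `b` and `c`. The main term of the second moment and the constant
      -- `P *ℕ P` add up to `2 n² P²`, which cancels against the cross term on the left.
      variance : β *ℕ (γ *ℕ K) ≤ℕ n *ℕ n *ℕ (α *ℕ (m *ℕ (n *ℕ δ)))
      variance = ℕ.+-cancelˡ-≤ ((2 *ℕ n *ℕ P) *ℕ (n *ℕ P)) _ _ (begin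
        (2 *ℕ n *ℕ P) *ℕ (n *ℕ P) +ℕ β *ℕ (γ *ℕ K)
          ≡⟨ total-left ⟨
        ∑ (λ b → ∑ (λ c → (2 *ℕ n *ℕ P) *ℕ line b c +ℕ χ B b *ℕ χ C c *ℕ K))
          ≤⟨ ∑-mono-≤ (λ b → ∑-mono-≤ (deviation B C e (sym δ+e≡n) full b)) ⟩
        ∑ (λ b → ∑ (λ c → n *ℕ n *ℕ (line b c *ℕ line b c) +ℕ P *ℕ P))
          ≡⟨ total-right ⟩
        n *ℕ n *ℕ ∑ (λ b → ∑ (λ c → line b c *ℕ line b c)) +ℕ n *ℕ (n *ℕ (P *ℕ P))
          ≤⟨ ℕ.+-monoˡ-≤ _ (ℕ.*-monoʳ-≤ (n *ℕ n) second-moment) ⟩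
        n *ℕ n *ℕ (α *ℕ (α *ℕ (δ *ℕ δ) +ℕ m *ℕ (n *ℕ δ))) +ℕ n *ℕ (n *ℕ (P *ℕ P))
          ≡⟨ collect n α δ (m *ℕ (n *ℕ δ)) ⟩
        (2 *ℕ n *ℕ P) *ℕ (n *ℕ P) +ℕ n *ℕ n *ℕ (α *ℕ (m *ℕ (n *ℕ δ))) ∎)
        where
        open ℕ.≤-Reasoning
        collect : ∀ n α δ x →
          n *ℕ n *ℕ (α *ℕ (α *ℕ (δ *ℕ δ) +ℕ x)) +ℕ n *ℕ (n *ℕ (α *ℕ δ *ℕ (α *ℕ δ))) ≡
          (2 *ℕ n *ℕ (α *ℕ δ)) *ℕ (n *ℕ (α *ℕ δ)) +ℕ n *ℕ n *ℕ (α *ℕ x)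
        collect = solve-∀

      n≤2e : n ≤ℕ 2 *ℕ e
      n≤2e = begin
        n            ≡⟨ δ+e≡n ⟨
        δ +ℕ e       ≤⟨ ℕ.+-monoˡ-≤ e δ≤e ⟩
        e +ℕ e       ≡⟨ cong (e +ℕ_) (ℕ.+-identityʳ e) ⟨
        2 *ℕ e       ∎
        where
        open ℕ.≤-Reasoning
        δ≤e : δ ≤ℕ e
        δ≤e = ℕ.+-cancelˡ-≤ δ _ _ (begin
          δ +ℕ δ   ≡⟨ cong (δ +ℕ_) (ℕ.+-identityʳ δ) ⟨
          2 *ℕ δ   ≤⟨ 2δ≤n ⟩
          n        ≡⟨ δ+e≡n ⟨
          δ +ℕ e   ∎)

      -- The constant 4 arises from `n² ≤ 4 e²`. Carrying the factor `n *ℕ n *ℕ α` on both sides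
      -- allows `variance` to be applied without division.
      scaled : n *ℕ n *ℕ α *ℕ (α *ℕ β *ℕ γ) ≤ℕ n *ℕ n *ℕ α *ℕ (4 *ℕ (m *ℕ n *ℕ δ))
      scaled = begin
        n *ℕ n *ℕ α *ℕ (α *ℕ β *ℕ γ)
          ≤⟨ ℕ.*-monoˡ-≤ (α *ℕ β *ℕ γ) (ℕ.*-monoˡ-≤ α (ℕ.*-mono-≤ n≤2e n≤2e)) ⟩
        2 *ℕ e *ℕ (2 *ℕ e) *ℕ α *ℕ (α *ℕ β *ℕ γ)
          ≡⟨ regroup e α β γ ⟩
        4 *ℕ (β *ℕ (γ *ℕ K))
          ≤⟨ ℕ.*-monoʳ-≤ 4 variance ⟩
        4 *ℕ (n *ℕ n *ℕ (α *ℕ (m *ℕ (n *ℕ δ))))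
          ≡⟨ regroup′ n α m δ ⟩
        n *ℕ n *ℕ α *ℕ (4 *ℕ (m *ℕ n *ℕ δ)) ∎
        where
        open ℕ.≤-Reasoning
        regroup : ∀ e α β γ → 2 *ℕ e *ℕ (2 *ℕ e) *ℕ α *ℕ (α *ℕ β *ℕ γ) ≡
                              4 *ℕ (β *ℕ (γ *ℕ (α *ℕ α *ℕ (e *ℕ e))))
        regroup = solve-∀
        regroup′ : ∀ n α m δ → 4 *ℕ (n *ℕ n *ℕ (α *ℕ (m *ℕ (n *ℕ δ)))) ≡
                               n *ℕ n *ℕ α *ℕ (4 *ℕ (m *ℕ n *ℕ δ))
        regroup′ = solve-∀

      conclusion : α *ℕ β *ℕ γ ≤ℕ 4 *ℕ (m *ℕ n *ℕ δ)
      conclusion with α ℕ.≟ 0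
      -- Cancelling needs a nonzero factor: `α = 0` makes the left side 0, and otherwise
      -- `n ≥ α > 0`.
      ... | yes α≡0 rewrite α≡0 = z≤n
      ... | no  α≢0 = ℕ.*-cancelˡ-≤ (n *ℕ n *ℕ α) scaled
        where
        instance
          α-nonZero = ≢-nonZero α≢0
          n-nonZero = >-nonZero (ℕ.<-≤-trans (ℕ.n≢0⇒n>0 α≢0) (∣p∣≤n A))
          n²-nonZero = ℕ.m*n≢0 n n
          n²α-nonZero = ℕ.m*n≢0 (n *ℕ n) α

  -- For `D = BA + C` a line from `B × C` sends all of `A` into `D`, which is the hypothesis `full`.
  -- Here `U` stands for any set containing all non-units.
  BA+C-bound : (U : RSubset) → (∀ u → ¬ (u ∈ᴿ U) → Invertible u) → ∀ A B C →
    let δ = ∣ B ⟨*⟩ A ⟨+⟩ C ∣ in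
    size ≤ℕ 2 *ℕ δ ⊎ ∣ A ∣ *ℕ ∣ B ∣ *ℕ ∣ C ∣ ≤ℕ 4 *ℕ (∣ U ∣ *ℕ size *ℕ δ)
  BA+C-bound U ∉U⇒invertible A B C = dichotomy B C full
    where
    D = B ⟨*⟩ A ⟨+⟩ C
    open Incidences U ∉U⇒invertible A D
    full : ∀ {b c} → b ∈ᴿ B → c ∈ᴿ C → line b c ≡ ∣ A ∣
    full {b} {c} b∈B c∈C = trans (∑-cong pointwise) (∑-χ A)
      where
      pointwise : ∀ x → χ A x *ℕ χ D (b * x + c) ≡ χ A x
      pointwise x with lookup A (index x) in eq
      ... | false = refl
      ... | true  = trans (ℕ.*-identityˡ _)
        (χ-∈ (image₂⁺ R.+-cong (image₂⁺ R.*-cong b∈B (lookup⇒[]= _ A eq)) c∈C))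

-- Valuation rings: the uniformiser and the powers of the maximal ideal.

module ValuationRingProperties {a ℓ} {R : FiniteRing a ℓ} {q r : ℕ}
  (isV : IsFiniteValuationRing R q r) where
  open FiniteRing R
  open FiniteRingProperties R
  open IsFiniteValuationRing isV
  open IsIdeal 𝔪-isIdeal using (0-mem; +-closed; *-absorb)
  open IsMaximal (proj₁ (proj₂ local)) using (maximal)
  open GroupProperties R.+-group using (//-rightDividesˡ; //-rightDividesʳ; ∙-cancelˡ; x≈y⇒x∙y⁻¹≈ε)
  open RingProperties R.ring using ([y-z]x≈yx-zx)
  open Exponentiation R.commutativeSemiring using (^-distrib-*) renaming (_^_ to _^ᴿ_)
  open Summation R.+-commutativeMonoid using () renaming (sum to sumᴿ)
  open SemiringSolver R.commutativeSemiring using (solve; _:=_; _:+_; _:*_)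

  ⊆-from-elements : ∀ {X Y} → (∀ {x} → x ∈ᴿ X → x ∈ᴿ Y) → X ⊆ Y
  ⊆-from-elements {X} {Y} X⊆Y {i} i∈X =
    subst (_∈ Y) (index-element i) (X⊆Y (subst (_∈ X) (sym (index-element i)) i∈X))

  private
    𝔪-principal = principal 𝔪 𝔪-isIdeal

  π : Carrier
  π = proj₁ 𝔪-principal

  ∈𝔪⇒multiple : ∀ {x} → x ∈ᴿ 𝔪 → ∃ λ y → x ≈ y * π
  ∈𝔪⇒multiple = Equivalence.to (proj₂ 𝔪-principal _)

  multiple∈𝔪 : ∀ y → y * π ∈ᴿ 𝔪
  multiple∈𝔪 y = Equivalence.from (proj₂ 𝔪-principal _) (y , R.refl)

  π∈𝔪 : π ∈ᴿ 𝔪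
  π∈𝔪 = ∈ᴿ-resp-≈ (R.*-identityˡ π) (multiple∈𝔪 1#)

  π^k∈𝔪^k : ∀ k → (𝔪 ^ᴵ k) (π ^ᴿ k)
  π^k∈𝔪^k zero    = Unit.tt
  π^k∈𝔪^k (suc k) = 1 , (λ _ → π) , (λ _ → π ^ᴿ k) , (λ _ → π∈𝔪) , (λ _ → π^k∈𝔪^k k) ,
                    R.sym (R.+-identityʳ _)

  sumᴿ-multiple : ∀ {n} (f : Fin n → Carrier) t → (∀ i → ∃ λ y → f i ≈ y * t) →
                  ∃ λ y → sumᴿ f ≈ y * t
  sumᴿ-multiple {zero}  f t multiples = 0# , R.sym (R.zeroˡ t)
  sumᴿ-multiple {suc n} f t multiples
    with y , fy ← multiples zero
       | z , fz ← sumᴿ-multiple (f ∘ suc) t (multiples ∘ suc) =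
    y + z , R.trans (R.+-cong fy fz) (R.sym (R.distribʳ t y z))

  𝔪^k⇒multiple : ∀ k {z} → (𝔪 ^ᴵ k) z → ∃ λ y → z ≈ y * π ^ᴿ k
  𝔪^k⇒multiple zero    {z} _ = z , R.sym (R.*-identityʳ z)
  𝔪^k⇒multiple (suc k) (n , x , y , x∈𝔪 , y∈𝔪^k , z≈) =
    let w , eq = sumᴿ-multiple (λ i → x i * y i) (π ^ᴿ suc k) multiple in w , R.trans z≈ eq
    where
    multiple : ∀ i → ∃ λ w → x i * y i ≈ w * (π * π ^ᴿ k)
    multiple i with s , xs ← ∈𝔪⇒multiple (x∈𝔪 i) | t , yt ← 𝔪^k⇒multiple k (y∈𝔪^k i) =
      s * t , R.trans (R.*-cong xs yt)
        (solve 4 (λ s p t p′ → (s :* p) :* (t :* p′) := (s :* t) :* (p :* p′)) R.refl s π t (π ^ᴿ k))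

  π^r≈0 : π ^ᴿ r ≈ 0#
  π^r≈0 = 𝔪^r-zero (π^k∈𝔪^k r)

  -- All elements of `𝔪 ^ᴵ k` are multiples of `π ^ᴿ k`, so this ideal vanishes with that power, and
  -- the minimality of `r` applies.
  π^k≈0⇒r≤k : ∀ k → π ^ᴿ k ≈ 0# → r ≤ℕ k
  π^k≈0⇒r≤k k π^k≈0 = r-least k λ z∈ →
    let y , z≈ = 𝔪^k⇒multiple k z∈
    in R.trans z≈ (R.trans (R.*-congˡ π^k≈0) (R.zeroʳ y))

  -- Nilpotence inside `𝔪` and invertibility outside it.

  ∈𝔪-nilpotent : ∀ {x} → x ∈ᴿ 𝔪 → x ^ᴿ r ≈ 0#
  ∈𝔪-nilpotent {x} x∈𝔪 with y , x≈ ← ∈𝔪⇒multiple x∈𝔪 = begin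
    x ^ᴿ r            ≈⟨ ^-congˡ r x≈ ⟩
    (y * π) ^ᴿ r      ≈⟨ ^-distrib-* y π r ⟩
    y ^ᴿ r * π ^ᴿ r   ≈⟨ R.*-congˡ π^r≈0 ⟩
    y ^ᴿ r * 0#       ≈⟨ R.zeroʳ _ ⟩
    0#                ∎
    where
    open SetoidReasoning R.setoid
    open Exponentiation R.commutativeSemiring using (^-congˡ)

  -- Modulo `u` the element `m` is 1, hence so are its powers. Once `m ^ᴿ k` vanishes, `w` is an
  -- inverse of `u`.
  complement-of-power : ∀ {m u} → m + u ≈ 1# → ∀ k → ∃ λ w → u * w + m ^ᴿ k ≈ 1#
  complement-of-power {m} {u} m+u≈1 zero    = 0# , R.trans (R.+-congʳ (R.zeroʳ u)) (R.+-identityˡ 1#)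
  complement-of-power {m} {u} m+u≈1 (suc k) with w , eq ← complement-of-power m+u≈1 k =
    w + m ^ᴿ k , (begin
      u * (w + m ^ᴿ k) + m * m ^ᴿ k   ≈⟨ solve 4 (λ u w p m →
                                           u :* (w :+ p) :+ m :* p := u :* w :+ (m :+ u) :* p)
                                           R.refl u w (m ^ᴿ k) m ⟩
      u * w + (m + u) * m ^ᴿ k        ≈⟨ R.+-congˡ (R.trans (R.*-congʳ m+u≈1) (R.*-identityˡ _)) ⟩
      u * w + m ^ᴿ k                  ≈⟨ eq ⟩
      1#                              ∎)
    where open SetoidReasoning R.setoid

  module _ (u : Carrier) where
    combination : Carrier → Carrier → Carrier
    combination m y = m + y * u

    combination-cong : Congruent₂ combination
    combination-cong p q = R.+-cong p (R.*-congʳ q)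

    -- The ideal generated by `𝔪` and `u`, built as an `RSubset` so that maximality applies to it;
    -- `⊤` supplies the arbitrary coefficients of `u`.
    𝔪+⟨_⟩ : RSubset
    𝔪+⟨_⟩ = image₂ combination 𝔪 ⊤

    private
      ∈⁺ : ∀ {m z} y → m ∈ᴿ 𝔪 → z ≈ m + y * u → z ∈ᴿ 𝔪+⟨_⟩
      ∈⁺ y m∈𝔪 z≈ = ∈ᴿ-resp-≈ (R.sym z≈) (image₂⁺ combination-cong m∈𝔪 ∈⊤)

    𝔪⊆𝔪+⟨u⟩ : ∀ {x} → x ∈ᴿ 𝔪 → x ∈ᴿ 𝔪+⟨_⟩
    𝔪⊆𝔪+⟨u⟩ {x} x∈𝔪 = ∈⁺ 0# x∈𝔪 (R.sym (R.trans (R.+-congˡ (R.zeroˡ u)) (R.+-identityʳ x)))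

    u∈𝔪+⟨u⟩ : u ∈ᴿ 𝔪+⟨_⟩
    u∈𝔪+⟨u⟩ = ∈⁺ 1# 0-mem (R.sym (R.trans (R.+-identityˡ _) (R.*-identityˡ u)))

    𝔪+⟨u⟩-isIdeal : IsIdeal 𝔪+⟨_⟩
    𝔪+⟨u⟩-isIdeal = record
      { 0-mem    = 𝔪⊆𝔪+⟨u⟩ 0-mem
      ; +-closed = λ x∈ y∈ →
          let m , s , m∈𝔪 , _ , x≈ = image₂⁻ {combination} {𝔪} {⊤} x∈
              n , t , n∈𝔪 , _ , y≈ = image₂⁻ {combination} {𝔪} {⊤} y∈
          in ∈⁺ (s + t) (+-closed m∈𝔪 n∈𝔪) (R.trans (R.+-cong x≈ y≈)
               (solve 5 (λ m s n t u → (m :+ s :* u) :+ (n :+ t :* u) := (m :+ n) :+ (s :+ t) :* u)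
                 R.refl m s n t u))
      ; *-absorb = λ x y∈ →
          let m , s , m∈𝔪 , _ , y≈ = image₂⁻ {combination} {𝔪} {⊤} y∈
          in ∈⁺ (x * s) (*-absorb x m∈𝔪) (R.trans (R.*-congˡ y≈)
               (solve 4 (λ x m s u → x :* (m :+ s :* u) := x :* m :+ (x :* s) :* u)
                 R.refl x m s u))
      }

  -- By maximality 1 = m + y u with m ∈ 𝔪 nilpotent, so y u is invertible.
  ∉𝔪⇒invertible : ∀ u → ¬ (u ∈ᴿ 𝔪) → Invertible u
  ∉𝔪⇒invertible u u∉𝔪
    with maximal 𝔪+⟨ u ⟩ (𝔪+⟨u⟩-isIdeal u) (⊆-from-elements (𝔪⊆𝔪+⟨u⟩ u))
  ... | inj₁ ≡𝔪 = contradiction (subst (u ∈ᴿ_) ≡𝔪 (u∈𝔪+⟨u⟩ u)) u∉𝔪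
  ... | inj₂ ≡⊤
    with m , y , m∈𝔪 , _ , 1≈ ← image₂⁻ {combination u} {𝔪} {⊤} (subst (1# ∈ᴿ_) (sym ≡⊤) ∈⊤)
    with w , eq ← complement-of-power (R.sym 1≈) r =
    y * w , (begin
      u * (y * w)             ≈⟨ solve 3 (λ u y w → u :* (y :* w) := (y :* u) :* w) R.refl u y w ⟩
      y * u * w               ≈⟨ R.+-identityʳ _ ⟨
      y * u * w + 0#          ≈⟨ R.+-congˡ (∈𝔪-nilpotent m∈𝔪) ⟨
      y * u * w + m ^ᴿ r      ≈⟨ eq ⟩
      1#                      ∎)
    where open SetoidReasoning R.setoid

  -- π-adic expansions and the sizes of the ring and of `𝔪`.

  open Setoid (quotient 𝔪-isIdeal) using ()
    renaming (_≈_ to _≡𝔪_; sym to ≡𝔪-sym; trans to ≡𝔪-trans)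
  open Inverse residueField-size using ()
    renaming (to to representative; from to residue; from-cong to residue-cong;
              strictlyInverseˡ to representative-residue; strictlyInverseʳ to residue-representative)

  representative-injective : ∀ {s t} → representative s ≡𝔪 representative t → s ≡ t
  representative-injective {s} {t} s≡t =
    trans (sym (residue-representative s)) (trans (residue-cong s≡t) (residue-representative t))

  +π-≡𝔪 : ∀ x y → x + y * π ≡𝔪 x
  +π-≡𝔪 x y = ∈ᴿ-resp-≈ (R.sym (R.trans (R.+-congʳ (R.+-comm x (y * π))) (//-rightDividesʳ x (y * π))))
    (multiple∈𝔪 y)

  -- The base-`q` digits of the index serve as coefficients of a polynomial in `π`, evaluated in
  -- Horner form; the first component of `remQuot` is the constant term.
  expansion : ∀ k → Fin (q ^ k) → Carrier
  expansion zero    _ = 0#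
  expansion (suc k) i = let s , j = remQuot (q ^ k) i in representative s + expansion k j * π

  expansion-combine : ∀ k s j →
    expansion (suc k) (combine s j) ≡ representative s + expansion k j * π
  expansion-combine k s j =
    cong (λ (s , j) → representative s + expansion k j * π) (remQuot-combine s j)

  -- Subtracting from `x` the representative of its residue leaves an element of `𝔪`, a multiple of
  -- `π` whose cofactor is expanded in turn.
  expand : ∀ k x → ∃ λ i → ∃ λ y → x ≈ expansion k i + y * π ^ᴿ k
  expand zero    x = zero , x , R.sym (R.trans (R.+-identityˡ _) (R.*-identityʳ x))
  expand (suc k) x
    with y , x-s≈yπ ← ∈𝔪⇒multiple (≡𝔪-sym {representative (residue x)} {x} (representative-residue x))
    with i , z , y≈ ← expand k y =
    combine s i , z , (begin
      x
        ≈⟨ //-rightDividesˡ (representative s) x ⟨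
      (x - representative s) + representative s
        ≈⟨ R.+-comm _ _ ⟩
      representative s + (x - representative s)
        ≈⟨ R.+-congˡ (R.trans x-s≈yπ (R.*-congʳ y≈)) ⟩
      representative s + (expansion k i + z * π ^ᴿ k) * π
        ≈⟨ solve 5 (λ s d z p π → s :+ (d :+ z :* p) :* π := (s :+ d :* π) :+ z :* (π :* p))
             R.refl (representative s) (expansion k i) z (π ^ᴿ k) π ⟩
      representative s + expansion k i * π + z * (π * π ^ᴿ k)
        ≡⟨ cong (_+ z * (π * π ^ᴿ k)) (expansion-combine k s i) ⟨
      expansion (suc k) (combine s i) + z * (π * π ^ᴿ k) ∎)
    where
    open SetoidReasoning R.setoid
    s = residue x

  -- Unless the leading digits agree, the difference of the two expansions is
  -- invertible and hence π ^ j = 0, which is impossible for j < r.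
  leading-digit : ∀ {j} s t x y → j < r →
    (representative s + x * π) * π ^ᴿ j ≈ (representative t + y * π) * π ^ᴿ j → s ≡ t
  leading-digit {j} s t x y j<r eq = agree (index (d - e) ∈? 𝔪)
    where
    open SetoidReasoning R.setoid
    d = representative s + x * π
    e = representative t + y * π
    agree : Dec (d - e ∈ᴿ 𝔪) → s ≡ t
    agree (yes d-e∈𝔪) = representative-injective
      (≡𝔪-trans {representative s} {d} {representative t}
        (≡𝔪-sym {d} {representative s} (+π-≡𝔪 (representative s) x))
        (≡𝔪-trans {d} {e} {representative t} d-e∈𝔪 (+π-≡𝔪 (representative t) y)))
    agree (no d-e∉𝔪) with v , uv≈1 ← ∉𝔪⇒invertible (d - e) d-e∉𝔪 =
      contradiction j<r (ℕ.≤⇒≯ (π^k≈0⇒r≤k j (begin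
        π ^ᴿ j                      ≈⟨ R.*-identityˡ _ ⟨
        1# * π ^ᴿ j                 ≈⟨ R.*-congʳ uv≈1 ⟨
        (d - e) * v * π ^ᴿ j        ≈⟨ R.*-congʳ (R.*-comm (d - e) v) ⟩
        v * (d - e) * π ^ᴿ j        ≈⟨ R.*-assoc v (d - e) (π ^ᴿ j) ⟩
        v * ((d - e) * π ^ᴿ j)      ≈⟨ R.*-congˡ (R.trans ([y-z]x≈yx-zx (π ^ᴿ j) d e) (x≈y⇒x∙y⁻¹≈ε eq)) ⟩
        v * 0#                      ≈⟨ R.zeroʳ v ⟩
        0#                          ∎)))

  -- `π` is nilpotent and cannot be cancelled, so stripping a digit moves one factor `π` into the
  -- power. The invariant `j +ℕ k ≡ r` keeps `j < r` while digits remain, as `leading-digit`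
  -- requires.
  expansion-injective : ∀ k j → j +ℕ k ≡ r → ∀ {s t} →
    expansion k s * π ^ᴿ j ≈ expansion k t * π ^ᴿ j → s ≡ t
  expansion-injective zero    j _      {zero} {zero} _ = refl
  expansion-injective (suc k) j j+1+k≡r {s} {t} eq
    with s₁ , s₂ , refl ← combine-surjective {q} {q ^ k} s
       | t₁ , t₂ , refl ← combine-surjective {q} {q ^ k} t
    rewrite expansion-combine k s₁ s₂ | expansion-combine k t₁ t₂
    with refl ← leading-digit s₁ t₁ (expansion k s₂) (expansion k t₂)
                  (ℕ.m+n≤o⇒m≤o (suc j) (ℕ.≤-reflexive (trans (sym (ℕ.+-suc j k)) j+1+k≡r))) eq =
    cong (combine s₁) (expansion-injective k (suc j) 1+j+k≡r tails)
    where
    1+j+k≡r : suc j +ℕ k ≡ r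
    1+j+k≡r = trans (sym (ℕ.+-suc j k)) j+1+k≡r
    split : ∀ x → (representative s₁ + x * π) * π ^ᴿ j ≈ representative s₁ * π ^ᴿ j + x * (π * π ^ᴿ j)
    split x = R.trans (R.distribʳ (π ^ᴿ j) (representative s₁) (x * π)) (R.+-congˡ (R.*-assoc x π (π ^ᴿ j)))
    tails : expansion k s₂ * (π * π ^ᴿ j) ≈ expansion k t₂ * (π * π ^ᴿ j)
    tails = ∙-cancelˡ (representative s₁ * π ^ᴿ j) _ _
      (R.trans (R.sym (split _)) (R.trans eq (split _)))

  -- Injections both ways: since `π ^ᴿ r` vanishes, `r` digits determine an element, and
  -- `expansion-injective` with `j = 0` shows that distinct digit strings give distinct elements.
  size≡q^r : size ≡ q ^ r
  size≡q^r = ℕ.≤-antisym (injective⇒≤ {f = digits} digits-injective) (injective⇒≤ {f = value} value-injective)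
    where
    digits : Fin size → Fin (q ^ r)
    digits i = proj₁ (expand r (element i))
    value : Fin (q ^ r) → Fin size
    value = index ∘ expansion r
    value-digits : ∀ i → value (digits i) ≡ i
    value-digits i with s , y , x≈ ← expand r (element i) = trans
      (index-cong (R.sym (begin
        element i                      ≈⟨ x≈ ⟩
        expansion r s + y * π ^ᴿ r     ≈⟨ R.+-congˡ (R.trans (R.*-congˡ π^r≈0) (R.zeroʳ y)) ⟩
        expansion r s + 0#             ≈⟨ R.+-identityʳ _ ⟩
        expansion r s                  ∎)))
      (index-element i)
      where open SetoidReasoning R.setoid
    digits-injective : ∀ {i j} → digits i ≡ digits j → i ≡ j
    digits-injective {i} {j} eq = trans (sym (value-digits i)) (trans (cong value eq) (value-digits j))
    value-injective : ∀ {s t} → value s ≡ value t → s ≡ t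
    value-injective {s} {t} eq = expansion-injective r 0 refl (R.*-congʳ (begin
      expansion r s            ≈⟨ element-index _ ⟨
      element (value s)        ≡⟨ cong element eq ⟩
      element (value t)        ≈⟨ element-index _ ⟩
      expansion r t            ∎))
      where open SetoidReasoning R.setoid

  -- An element of `𝔪` is `y * π`, and the first `k = r - 1` digits of `y` determine it, because the
  -- remainder acquires the factor `π ^ᴿ r`, which is 0.
  ∣𝔪∣≤q^[r-1] : ∀ {k} → suc k ≡ r → ∣ 𝔪 ∣ ≤ℕ q ^ k
  ∣𝔪∣≤q^[r-1] {k} refl = ∣X∣≤covering 𝔪 (λ s → index (expansion k s * π)) covers
    where
    covers : ∀ {i} → i ∈ 𝔪 → ∃ λ s → index (expansion k s * π) ≡ i
    covers {i} i∈𝔪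
      with y , x≈ ← ∈𝔪⇒multiple (subst (_∈ 𝔪) (sym (index-element i)) i∈𝔪)
      with s , z , y≈ ← expand k y = s , trans
        (index-cong (R.sym (begin
          element i
            ≈⟨ R.trans x≈ (R.*-congʳ y≈) ⟩
          (expansion k s + z * π ^ᴿ k) * π
            ≈⟨ solve 4 (λ d z p π → (d :+ z :* p) :* π := d :* π :+ z :* (π :* p))
                 R.refl (expansion k s) z (π ^ᴿ k) π ⟩
          expansion k s * π + z * (π * π ^ᴿ k)
            ≈⟨ R.+-congˡ (R.trans (R.*-congˡ π^r≈0) (R.zeroʳ z)) ⟩
          expansion k s * π + 0#
            ≈⟨ R.+-identityʳ _ ⟩
          expansion k s * π ∎)))
        (index-element i)
      where open SetoidReasoning R.setoid

  ∣𝔪∣*size≤q^[2r-1] : ∣ 𝔪 ∣ *ℕ size ≤ℕ q ^ (2 *ℕ r ∸ 1)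
  ∣𝔪∣*size≤q^[2r-1] with k , refl ← ℕ.m≤n⇒∃[o]m+o≡n r≥1 = begin
    ∣ 𝔪 ∣ *ℕ size               ≤⟨ ℕ.*-mono-≤ (∣𝔪∣≤q^[r-1] refl) (ℕ.≤-reflexive size≡q^r) ⟩
    q ^ k *ℕ q ^ suc k          ≡⟨ ℕ.^-distribˡ-+-* q k (suc k) ⟨
    -- `2 *ℕ suc k ∸ 1` computes to `k +ℕ (suc k +ℕ 0)`, hence the trailing 0.
    q ^ (k +ℕ suc k)            ≡⟨ cong (λ e → q ^ (k +ℕ e)) (ℕ.+-identityʳ (suc k)) ⟨
    q ^ (2 *ℕ suc k ∸ 1)        ∎
    where open ℕ.≤-Reasoning

  q^r≤4∣BA+C∣⊎ : ∀ A B C → let δ = ∣ B ⟨*⟩ A ⟨+⟩ C ∣ in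
    q ^ r ≤ℕ 4 *ℕ δ ⊎ ∣ A ∣ *ℕ ∣ B ∣ *ℕ ∣ C ∣ ≤ℕ 4 *ℕ δ *ℕ q ^ (2 *ℕ r ∸ 1)
  q^r≤4∣BA+C∣⊎ A B C with BA+C-bound 𝔪 ∉𝔪⇒invertible A B C
  ... | inj₁ n≤2δ = inj₁ (begin
    q ^ r       ≡⟨ size≡q^r ⟨
    size        ≤⟨ n≤2δ ⟩
    -- Weakened from 2 to 4 so that both alternatives share one constant.
    2 *ℕ δ      ≤⟨ ℕ.*-monoˡ-≤ δ (ℕ.m≤m+n 2 2) ⟩
    4 *ℕ δ      ∎)
    where
    open ℕ.≤-Reasoning
    δ = ∣ B ⟨*⟩ A ⟨+⟩ C ∣
  ... | inj₂ αβγ≤ = inj₂ (begin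
    ∣ A ∣ *ℕ ∣ B ∣ *ℕ ∣ C ∣              ≤⟨ αβγ≤ ⟩
    4 *ℕ (∣ 𝔪 ∣ *ℕ size *ℕ δ)            ≤⟨ ℕ.*-monoʳ-≤ 4 (ℕ.*-monoˡ-≤ δ ∣𝔪∣*size≤q^[2r-1]) ⟩
    4 *ℕ (q ^ (2 *ℕ r ∸ 1) *ℕ δ)         ≡⟨ cong (4 *ℕ_) (ℕ.*-comm _ δ) ⟩
    4 *ℕ (δ *ℕ q ^ (2 *ℕ r ∸ 1))         ≡⟨ ℕ.*-assoc 4 δ _ ⟨
    4 *ℕ δ *ℕ q ^ (2 *ℕ r ∸ 1)           ∎)
    where
    open ℕ.≤-Reasoning
    δ = ∣ B ⟨*⟩ A ⟨+⟩ C ∣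

-- Passage to rational inequalities.

open import Data.Rational.Base using (ℚ; 0ℚ; _/_; _⊓_; toℚᵘ; _*_; _≤_) renaming (_<_ to _<ℚ_)

-- Comparing unnormalised fractions reduces the claim to cross multiplication in the integers, away
-- from reduction to lowest terms.
/≤⌜⌝*⌜⌝ : ∀ b d .{{_ : NonZero d}} k e → b ≤ℕ k *ℕ e *ℕ d → + b / d ≤ ⌜ k ⌝ * ⌜ e ⌝
/≤⌜⌝*⌜⌝ b (suc d) k e b≤ked = ℚ.toℚᵘ-cancel-≤ (begin
  toℚᵘ (+ b / suc d)
    ≃⟨ ℚ.toℚᵘ-fromℚᵘ (ℚᵘ.mkℚᵘ (+ b) d) ⟩
  ℚᵘ.mkℚᵘ (+ b) d
    ≤⟨ ℚᵘ.*≤* cross-multiplied ⟩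
  ℚᵘ.mkℚᵘ (+ k) 0 ℚᵘ.* ℚᵘ.mkℚᵘ (+ e) 0
    ≃⟨ ℚᵘ.*-cong (ℚ.toℚᵘ-fromℚᵘ (ℚᵘ.mkℚᵘ (+ k) 0)) (ℚ.toℚᵘ-fromℚᵘ (ℚᵘ.mkℚᵘ (+ e) 0)) ⟨
  toℚᵘ ⌜ k ⌝ ℚᵘ.* toℚᵘ ⌜ e ⌝
    ≃⟨ ℚ.toℚᵘ-homo-* ⌜ k ⌝ ⌜ e ⌝ ⟨
  toℚᵘ (⌜ k ⌝ * ⌜ e ⌝) ∎)
  where
  cross-multiplied : + b ℤ.* + 1 ℤ.≤ (+ k ℤ.* + e) ℤ.* + suc d
  cross-multiplied = begin
    + b ℤ.* + 1                  ≡⟨ ℤ.*-identityʳ (+ b) ⟩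
    + b                          ≤⟨ ℤ.+≤+ b≤ked ⟩
    + (k *ℕ e *ℕ suc d)          ≡⟨ ℤ.pos-* (k *ℕ e) (suc d) ⟩
    + (k *ℕ e) ℤ.* + suc d       ≡⟨ cong (ℤ._* + suc d) (ℤ.pos-* k e) ⟩
    + k ℤ.* + e ℤ.* + suc d      ∎
    where open ℤ.≤-Reasoning
  open ℚᵘ.≤-Reasoning

⌜⌝≤⌜⌝*⌜⌝ : ∀ a k e → a ≤ℕ k *ℕ e → ⌜ a ⌝ ≤ ⌜ k ⌝ * ⌜ e ⌝
⌜⌝≤⌜⌝*⌜⌝ a k e a≤ke =
  -- `⌜ a ⌝` is by definition the fraction with denominator 1.
  /≤⌜⌝*⌜⌝ a 1 k e (ℕ.≤-trans a≤ke (ℕ.≤-reflexive (sym (ℕ.*-identityʳ (k *ℕ e)))))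

0<⌜4⌝ : 0ℚ <ℚ ⌜ 4 ⌝
0<⌜4⌝ = from-yes (0ℚ ℚ.<? ⌜ 4 ⌝)

⊓≤⌜⌝*⌜⌝ : ∀ a b d .{{_ : NonZero d}} k e → a ≤ℕ k *ℕ e ⊎ b ≤ℕ k *ℕ e *ℕ d →
  ⌜ a ⌝ ⊓ (+ b / d) ≤ ⌜ k ⌝ * ⌜ e ⌝
⊓≤⌜⌝*⌜⌝ a b d k e (inj₁ a≤ke)  = ℚ.≤-trans (ℚ.p⊓q≤p ⌜ a ⌝ (+ b / d)) (⌜⌝≤⌜⌝*⌜⌝ a k e a≤ke)
⊓≤⌜⌝*⌜⌝ a b d k e (inj₂ b≤ked) = ℚ.≤-trans (ℚ.p⊓q≤q ⌜ a ⌝ (+ b / d)) (/≤⌜⌝*⌜⌝ b d k e b≤ked)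

-- The three estimates, all with constant 4.

x³≡xxx : ∀ x → x ^ 3 ≡ x *ℕ x *ℕ x
x³≡xxx x = trans (cong (λ y → x *ℕ (x *ℕ y)) (ℕ.*-identityʳ x)) (sym (ℕ.*-assoc x x x))

theorem1p1 : ∀ {a ℓ : Level} →
  (∃ λ (c : ℚ) → 0ℚ <ℚ c ×
    (∀ {R : FiniteRing a ℓ} {q r : ℕ} (isV : IsFiniteValuationRing R q r) →
      let open FiniteRing R
          open IsFiniteValuationRing isV
          instance
            q^≢0 = q^-nonZero (2 *ℕ r ∸ 1)
      in (A B C : RSubset) → Nonempty A → Nonempty B → Nonempty C →
      ⌜ q ^ r ⌝ ⊓ (+ (∣ A ∣ *ℕ ∣ B ∣ *ℕ ∣ C ∣) / (q ^ (2 *ℕ r ∸ 1)))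
        ≤ c * ⌜ ∣ B ⟨*⟩ A ⟨+⟩ C ∣ ⌝))
  ×
  (∃ λ (c : ℚ) → 0ℚ <ℚ c ×
    (∀ {R : FiniteRing a ℓ} {q r : ℕ} (isV : IsFiniteValuationRing R q r) →
      let open FiniteRing R
          open IsFiniteValuationRing isV
          instance
            q^≢0 = q^-nonZero (2 *ℕ r ∸ 1)
      in (A : RSubset) → Nonempty A →
      ⌜ q ^ r ⌝ ⊓ (+ (∣ A ∣ ^ 3) / (q ^ (2 *ℕ r ∸ 1)))
        ≤ c * ⌜ ∣ A ⟨*⟩ A ⟨+⟩ A ∣ ⌝))
  ×
  (∃ λ (c : ℚ) → 0ℚ <ℚ c ×
    (∀ {R : FiniteRing a ℓ} {q r : ℕ} (isV : IsFiniteValuationRing R q r) →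
      let open FiniteRing R
      in (A : RSubset) → Nonempty A →
      -- |A| > q ^ (r - 1/3), cubed
      q ^ (3 *ℕ r ∸ 1) < ∣ A ∣ ^ 3 →
      ⌜ q ^ r ⌝ ≤ c * ⌜ ∣ A ⟨*⟩ A ⟨+⟩ A ∣ ⌝))
theorem1p1 =
  (⌜ 4 ⌝ , 0<⌜4⌝ , λ {R} {q} {r} isV A B C _ _ _ → let open FiniteRing R in
    ⊓≤⌜⌝*⌜⌝ (q ^ r) _ (q ^ (2 *ℕ r ∸ 1)) {{q^-nonZero isV (2 *ℕ r ∸ 1)}} 4 ∣ B ⟨*⟩ A ⟨+⟩ C ∣
      (q^r≤4∣BA+C∣⊎ isV A B C)) ,
  (⌜ 4 ⌝ , 0<⌜4⌝ , λ {R} {q} {r} isV A _ → let open FiniteRing R in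
    ⊓≤⌜⌝*⌜⌝ (q ^ r) _ (q ^ (2 *ℕ r ∸ 1)) {{q^-nonZero isV (2 *ℕ r ∸ 1)}} 4 ∣ A ⟨*⟩ A ⟨+⟩ A ∣
      (cubic isV A)) ,
  (⌜ 4 ⌝ , 0<⌜4⌝ , λ {R} {q} {r} isV A _ large → let open FiniteRing R in
    -- For large `A`, `cancel` turns the second alternative into the first, and `reduce` merges the
    -- two.
    ⌜⌝≤⌜⌝*⌜⌝ (q ^ r) 4 ∣ A ⟨*⟩ A ⟨+⟩ A ∣ (reduce (Sum.map₂ (cancel isV large) (cubic isV A))))
  where
  open IsFiniteValuationRing using (q^-nonZero)
  open ValuationRingProperties using (q^r≤4∣BA+C∣⊎)

  cubic : ∀ {a ℓ} {R : FiniteRing a ℓ} {q r} (isV : IsFiniteValuationRing R q r) →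
    let open FiniteRing R in (A : RSubset) →
    q ^ r ≤ℕ 4 *ℕ ∣ A ⟨*⟩ A ⟨+⟩ A ∣ ⊎ ∣ A ∣ ^ 3 ≤ℕ 4 *ℕ ∣ A ⟨*⟩ A ⟨+⟩ A ∣ *ℕ q ^ (2 *ℕ r ∸ 1)
  cubic isV A = Sum.map₂ (ℕ.≤-trans (ℕ.≤-reflexive (x³≡xxx ∣ A ∣))) (q^r≤4∣BA+C∣⊎ isV A A A)

  -- The exponents `r` and `2 r - 1` add up to `3 r - 1`, so `q ^ (2 *ℕ r ∸ 1)` cancels from both
  -- sides; `r≥1` keeps the truncated subtraction exact.
  cancel : ∀ {a ℓ} {R : FiniteRing a ℓ} {q r x y} → IsFiniteValuationRing R q r →
    q ^ (3 *ℕ r ∸ 1) < x → x ≤ℕ y *ℕ q ^ (2 *ℕ r ∸ 1) → q ^ r ≤ℕ y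
  cancel {q = q} {r} {x} {y} isV large x≤ =
    ℕ.*-cancelʳ-≤ _ _ (q ^ (2 *ℕ r ∸ 1)) {{q^-nonZero isV (2 *ℕ r ∸ 1)}} (begin
      q ^ r *ℕ q ^ (2 *ℕ r ∸ 1)     ≡⟨ ℕ.^-distribˡ-+-* q r (2 *ℕ r ∸ 1) ⟨
      q ^ (r +ℕ (2 *ℕ r ∸ 1))       ≡⟨ cong (q ^_) (ℕ.+-∸-assoc r (ℕ.≤-trans r≥1 (ℕ.m≤m+n r _))) ⟨
      q ^ (3 *ℕ r ∸ 1)              ≤⟨ ℕ.<⇒≤ large ⟩
      x                             ≤⟨ x≤ ⟩
      y *ℕ q ^ (2 *ℕ r ∸ 1)         ∎)
    where
    open ℕ.≤-Reasoning
    open IsFiniteValuationRing isV using (r≥1)
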